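{- Let $G$ be a finite simple bipartite graph with a perfect matching. Then $gf(G)\geq Af(G)$.
   Context: For a perfect matching $M$ of $G$, an anti-forcing set of $M$ is a subset $S\subseteq E(G)\setminus M$ such that $G-S$ (delete the edges of $S$) has a unique perfect matching; $af(G,M)$ is its minimum size and $Af(G)=\max_M af(G,M)$ over all perfect matchings $M$ of $G$. A global forcing set of $G$ is an edge subset $S$ such that no two distinct perfect matchings $M_1,M_2$ of $G$ satisfy $M_1\cap S=M_2\cap S$; $gf(G)$ is the minimum size of a global forcing set. -}

module Defs where

open import Data.Nat using (ℕ; _≤_)
open import Data.Fin using (Fin)
open import Data.Bool using (Bool)
open import Data.Product using (Σ; ∃; _×_; _,_)
open import Data.Sum using (_⊎_)
open import Relation.Binary.PropositionalEquality using (_≡_; _≢_)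
open import Data.Fin.Subset using (Subset; _∈_; _⊆_; _∩_; ∁; ⊥; ∣_∣)

record Graph : Set where
  field
    n    : ℕ
    m    : ℕ
    end₁ : Fin m → Fin n
    end₂ : Fin m → Fin n
    loopless : ∀ e → end₁ e ≢ end₂ e
    noMulti  : ∀ e f →
      ((end₁ e ≡ end₁ f × end₂ e ≡ end₂ f) ⊎ (end₁ e ≡ end₂ f × end₂ e ≡ end₁ f)) →
      e ≡ f

open Graph public

EdgeSet : Graph → Set
EdgeSet G = Subset (m G)

Incident : (G : Graph) → Fin (m G) → Fin (n G) → Set
Incident G e x = end₁ G e ≡ x ⊎ end₂ G e ≡ x

Bipartite : Graph → Set
Bipartite G = Σ (Fin (n G) → Bool) λ c → ∀ e → c (end₁ G e) ≢ c (end₂ G e)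

IsPerfectMatching : (G : Graph) → EdgeSet G → Set
IsPerfectMatching G M =
  ∀ x → (∃ λ e → e ∈ M × Incident G e x) ×
        (∀ e f → e ∈ M → f ∈ M → Incident G e x → Incident G f x → e ≡ f)

-- S is an anti-forcing set of M: S ⊆ E(G) \ M and G - S has a unique perfect
-- matching (necessarily M). Perfect matchings of G - S are exactly the perfect
-- matchings of G disjoint from S.
IsAntiForcingSet : (G : Graph) → EdgeSet G → EdgeSet G → Set
IsAntiForcingSet G M S =
  S ⊆ ∁ M ×
  (∀ M′ → IsPerfectMatching G M′ → M′ ∩ S ≡ ⊥ → M′ ≡ M)

IsAf : (G : Graph) → EdgeSet G → ℕ → Set
IsAf G M k =
  (∃ λ S → IsAntiForcingSet G M S × ∣ S ∣ ≡ k) ×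
  (∀ S → IsAntiForcingSet G M S → k ≤ ∣ S ∣)

IsAfMax : Graph → ℕ → Set
IsAfMax G k =
  (∃ λ M → IsPerfectMatching G M × IsAf G M k) ×
  (∀ M a → IsPerfectMatching G M → IsAf G M a → a ≤ k)

IsGlobalForcingSet : (G : Graph) → EdgeSet G → Set
IsGlobalForcingSet G S =
  ∀ M₁ M₂ → IsPerfectMatching G M₁ → IsPerfectMatching G M₂ →
  M₁ ∩ S ≡ M₂ ∩ S → M₁ ≡ M₂

IsGf : Graph → ℕ → Set
IsGf G k =
  (∃ λ S → IsGlobalForcingSet G S × ∣ S ∣ ≡ k) ×
  (∀ S → IsGlobalForcingSet G S → k ≤ ∣ S ∣)

{-# OPTIONS --safe #-}

-- Fix a perfect matching M and a global forcing set S of G, with colour classes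
-- A and B. If X ⊆ V(G) is a nonempty union of M-edges, then some a ∈ A ∩ X has
-- at most one edge in G[X] outside S: choose a perfect matching N that extends
-- M ∖ E(G[X]) and minimises |N ∩ S|. If every a ∈ A ∩ X had an edge in
-- G[X] − S − N, then these edges and N would form an N-alternating cycle, and
-- switching along it would either decrease |N ∩ S| or yield a second perfect
-- matching with the same trace on S.
-- Discard all edges of G[X] at a except the one in M, remove this M-edge from X
-- and repeat. The discarded edges form an anti-forcing set of M, and there are
-- at most |S| of them: at each a at most one of them lies outside S, and then
-- the M-edge at a lies in S.
module Submission where

open import Defs
open import Data.Bool using (true; false; if_then_else_)
open import Data.Bool.Properties using () renaming (_≟_ to _≟ᵇ_)
open import Data.Fin using (Fin; zero; suc; toℕ; _≟_)
open import Data.Fin.Properties using (any?; all?; pigeonhole; ¬∀⟶∃¬; suc-injective)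
open import Data.Fin.Subset
  using (Subset; inside; outside; _∈_; _∉_; _⊆_; _⊂_; _∩_; _∪_; _-_; ∁; ⊥; ∣_∣; Nonempty)
open import Data.Fin.Subset.Properties
open import Data.Nat using (ℕ; zero; suc; _+_; _∸_; _≤_; _<_; _≥_; z≤n)
open import Data.Nat.GeneralisedArithmetic using (fold; fold-+)
open import Data.Nat.Induction using (Acc; acc; <-wellFounded)
open import Data.Nat.Properties using (m∸n+n≡m; m<n⇒0<n∸m; <⇒≤; n<1+n; ≤-trans; ≤-<-trans)
open import Data.Product using (∃; ∃₂; _×_; _,_; proj₁; proj₂)
open import Data.Sum using (_⊎_; inj₁; inj₂; swap)
open import Data.Vec using ([]; _∷_; here; there; tabulate)
open import Data.Vec.Properties using ([]=⇒lookup; lookup⇒[]=; lookup∘tabulate)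
open import Function using (_∘_)
open import Relation.Binary.PropositionalEquality
  using (_≡_; _≢_; refl; sym; trans; cong; subst; module ≡-Reasoning)
open import Relation.Nullary using (¬_; yes; no; does; contradiction; ¬?; _×-dec_; _→-dec_)
open import Relation.Nullary.Decidable using (dec-true; dec-false; decidable-stable)
open import Relation.Unary using (Decidable)

-- Finite subsets, counting by injections, and iterated maps.

module _ {n} {P : Fin n → Set} (P? : Decidable P) where

  toSubset : Subset n
  toSubset = tabulate (does ∘ P?)

  ∈-toSubset⁺ : ∀ {x} → P x → x ∈ toSubset
  ∈-toSubset⁺ {x} px =
    lookup⇒[]= x _ (trans (lookup∘tabulate (does ∘ P?) x) (dec-true (P? x) px))

  ∈-toSubset⁻ : ∀ {x} → x ∈ toSubset → P x
  ∈-toSubset⁻ {x} x∈ with P? x | trans (sym (lookup∘tabulate (does ∘ P?) x)) ([]=⇒lookup x∈)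
  ... | yes px | _ = px
  ... | no _   | ()

⊆⇒≡⊎⊂ : ∀ {n} {p q : Subset n} → p ⊆ q → p ≡ q ⊎ p ⊂ q
⊆⇒≡⊎⊂ {p = p} {q} p⊆q with any? (λ x → (x ∈? q) ×-dec ¬? (x ∈? p))
... | yes new = inj₂ (p⊆q , new)
... | no ¬new = inj₁ (⊆-antisym p⊆q λ {x} x∈q →
  decidable-stable (x ∈? p) λ x∉p → ¬new (x , x∈q , x∉p))

injection⇒∣p∣≤∣q∣ : ∀ {m n} (p : Subset m) (q : Subset n) (f : Fin m → Fin n) →
  (∀ {x} → x ∈ p → f x ∈ q) →
  (∀ {x y} → x ∈ p → y ∈ p → f x ≡ f y → x ≡ y) → ∣ p ∣ ≤ ∣ q ∣
injection⇒∣p∣≤∣q∣ []            q f f∈ inj = z≤n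
injection⇒∣p∣≤∣q∣ (outside ∷ p) q f f∈ inj =
  injection⇒∣p∣≤∣q∣ p q (f ∘ suc) (f∈ ∘ there)
    (λ x∈ y∈ eq → suc-injective (inj (there x∈) (there y∈) eq))
injection⇒∣p∣≤∣q∣ (inside ∷ p)  q f f∈ inj =
  ≤-<-trans (injection⇒∣p∣≤∣q∣ p (q - f zero) (f ∘ suc)
    (λ x∈ → x∈p∧x≢y⇒x∈p-y (f∈ (there x∈))
      λ eq → contradiction (inj (there x∈) here eq) λ ())
    (λ x∈ y∈ eq → suc-injective (inj (there x∈) (there y∈) eq)))
    (x∈p⇒∣p-x∣<∣p∣ (f∈ here))

x∉p-x : ∀ {n} (p : Subset n) {x} → x ∉ p - x
x∉p-x (_ ∷ p) {zero}  ()
x∉p-x (_ ∷ p) {suc x} (there x∈) = x∉p-x p x∈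

-- Two of the first n + 1 iterates of x coincide. Writing the period as `suc p` makes `fold _ h p`
-- the predecessor map on the cycle.
periodic-point : ∀ {n} (h : Fin n → Fin n) (x : Fin n) →
  ∃₂ λ i p → fold (fold x h i) h (suc p) ≡ fold x h i
periodic-point {n} h x with pigeonhole (n<1+n n) (λ i → fold x h (toℕ i))
... | i , j , i<j , eq with toℕ j ∸ toℕ i in d | m<n⇒0<n∸m i<j
...   | suc p | _ = toℕ i , p , (begin
  fold (fold x h (toℕ i)) h (suc p) ≡⟨ fold-+ x h (suc p) ⟨
  fold x h (suc p + toℕ i)          ≡⟨ cong (λ k → fold x h (k + toℕ i)) d ⟨
  fold x h (toℕ j ∸ toℕ i + toℕ i)  ≡⟨ cong (fold x h) (m∸n+n≡m (<⇒≤ i<j)) ⟩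
  fold x h (toℕ j)                  ≡⟨ eq ⟨
  fold x h (toℕ i)                  ∎)
  where open ≡-Reasoning

fold-comm : ∀ {X : Set} (h : X → X) (x : X) k → fold (h x) h k ≡ h (fold x h k)
fold-comm h x zero    = refl
fold-comm h x (suc k) = cong h (fold-comm h x k)

-- Digraph covers and switching along cycles.

-- Contracting the edges of M turns G into a digraph on A whose loops are the
-- edges of M. A perfect matching of G becomes a choice of an outgoing edge
-- σ x at each x ∈ A such that t ∘ σ permutes A; values outside A are junk.
module Digraph {n m} (A : Fin n → Set) (s t : Fin m → Fin n) (loop : Fin n → Fin m)
  (A-s : ∀ e → A (s e)) (A-t : ∀ e → A (t e))
  (s-loop : ∀ {x} → A x → s (loop x) ≡ x) (t-loop : ∀ {x} → A x → t (loop x) ≡ x)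
  where

  record IsCover (σ : Fin n → Fin m) : Set where
    field
      s-σ      : ∀ {x} → A x → s (σ x) ≡ x
      inv      : Fin n → Fin n
      A-inv    : ∀ {x} → A x → A (inv x)
      inverseˡ : ∀ {x} → A x → inv (t (σ x)) ≡ x
      inverseʳ : ∀ {x} → A x → t (σ (inv x)) ≡ x

  loop-isCover : IsCover loop
  loop-isCover = record
    { s-σ = s-loop ; inv = λ x → x ; A-inv = λ a → a ; inverseˡ = t-loop ; inverseʳ = t-loop }

  -- For a cover this is the image of A: every `s e` lies in A, so junk values of σ are never
  -- consulted.
  selected : (Fin n → Fin m) → Subset m
  selected σ = toSubset (λ e → σ (s e) ≟ e)

  ∈-selected⁺ : ∀ σ {e} → σ (s e) ≡ e → e ∈ selected σ
  ∈-selected⁺ σ = ∈-toSubset⁺ (λ e → σ (s e) ≟ e)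

  ∈-selected⁻ : ∀ σ {e} → e ∈ selected σ → σ (s e) ≡ e
  ∈-selected⁻ σ = ∈-toSubset⁻ (λ e → σ (s e) ≟ e)

  -- With U as A ∩ X, this says that the matching extends the part of M outside G[X].
  LoopsOutside : Subset n → (Fin n → Fin m) → Set
  LoopsOutside U σ = ∀ {x} → A x → x ∉ U → σ x ≡ loop x

  module Switch {σ} (cover : IsCover σ) (U : Subset n) (U⊆A : ∀ {x} → x ∈ U → A x)
    (loops : LoopsOutside U σ) (g : Fin n → Fin m)
    (s-g : ∀ {x} → x ∈ U → s (g x) ≡ x) (t-g : ∀ {x} → x ∈ U → t (g x) ∈ U) where

    open IsCover cover

    -- Two steps of an alternating walk: forward along the g-edge, then back along the σ-edge with
    -- the same target.
    h : Fin n → Fin n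
    h x = inv (t (g x))

    -- If `inv z` were outside U, its σ-edge would be a loop ending at z, which makes z equal to
    -- `inv z`.
    inv∈U : ∀ {z} → z ∈ U → inv z ∈ U
    inv∈U {z} z∈U = decidable-stable (inv z ∈? U) λ ∉U → ∉U (subst (_∈ U) (z≡inv ∉U) z∈U)
      where
      a = U⊆A z∈U
      z≡inv : inv z ∉ U → z ≡ inv z
      z≡inv ∉U = begin
        z                  ≡⟨ inverseʳ a ⟨
        t (σ (inv z))      ≡⟨ cong t (loops (A-inv a) ∉U) ⟩
        t (loop (inv z))   ≡⟨ t-loop (A-inv a) ⟩
        inv z              ∎
        where open ≡-Reasoning

    h∈U : ∀ {x} → x ∈ U → h x ∈ U
    h∈U = inv∈U ∘ t-g

    fold-h∈U : ∀ {x} k → x ∈ U → fold x h k ∈ U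
    fold-h∈U zero    x∈U = x∈U
    fold-h∈U (suc k) x∈U = h∈U (fold-h∈U k x∈U)

    module Periodic (p : ℕ) where

      -- These points may form several cycles, of lengths dividing `suc p`; switching all of them at
      -- once avoids tracing a single one.
      OnCycle : Fin n → Set
      OnCycle x = x ∈ U × fold x h (suc p) ≡ x

      onCycle? : Decidable OnCycle
      onCycle? x = (x ∈? U) ×-dec (fold x h (suc p) ≟ x)

      σ′ : Fin n → Fin m
      σ′ x = if does (onCycle? x) then g x else σ x

      prev : Fin n → Fin n
      prev x = if does (onCycle? x) then fold x h p else x

      σ′-on : ∀ {x} → OnCycle x → σ′ x ≡ g x
      σ′-on {x} c rewrite dec-true (onCycle? x) c = refl

      σ′-off : ∀ {x} → ¬ OnCycle x → σ′ x ≡ σ x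
      σ′-off {x} ¬c rewrite dec-false (onCycle? x) ¬c = refl

      prev-on : ∀ {x} → OnCycle x → prev x ≡ fold x h p
      prev-on {x} c rewrite dec-true (onCycle? x) c = refl

      prev-off : ∀ {x} → ¬ OnCycle x → prev x ≡ x
      prev-off {x} ¬c rewrite dec-false (onCycle? x) ¬c = refl

      h-onCycle : ∀ {x} → OnCycle x → OnCycle (h x)
      h-onCycle {x} (x∈U , eq) = h∈U x∈U , trans (fold-comm h x (suc p)) (cong h eq)

      fold-onCycle : ∀ {x} k → OnCycle x → OnCycle (fold x h k)
      fold-onCycle zero    c = c
      fold-onCycle (suc k) c = h-onCycle (fold-onCycle k c)

      σ′-cases : ∀ x → σ′ x ≡ σ x ⊎ (x ∈ U × σ′ x ≡ g x)
      σ′-cases x with onCycle? x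
      ... | yes c = inj₂ (proj₁ c , σ′-on c)
      ... | no ¬c = inj₁ (σ′-off ¬c)

      σ′-loops : LoopsOutside U σ′
      σ′-loops a x∉U = trans (σ′-off (x∉U ∘ proj₁)) (loops a x∉U)

      -- As `t (g x)` equals `t (σ (h x))`, the map `t ∘ σ′` is `t ∘ σ` after h on the cycles and
      -- after the identity elsewhere. There `prev` inverts h, so `prev ∘ inv` is the inverse.
      σ′-isCover : IsCover σ′
      σ′-isCover = record
        { s-σ = s-σ′ ; inv = prev ∘ inv ; A-inv = A-prev ∘ A-inv
        ; inverseˡ = invˡ ; inverseʳ = invʳ }
        where
        s-σ′ : ∀ {x} → A x → s (σ′ x) ≡ x
        s-σ′ {x} a with σ′-cases x
        ... | inj₁ eq         = trans (cong s eq) (s-σ a)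
        ... | inj₂ (x∈U , eq) = trans (cong s eq) (s-g x∈U)

        A-prev : ∀ {x} → A x → A (prev x)
        A-prev {x} a with onCycle? x
        ... | yes c = subst A (sym (prev-on c)) (U⊆A (fold-h∈U p (proj₁ c)))
        ... | no ¬c = subst A (sym (prev-off ¬c)) a

        invˡ : ∀ {x} → A x → prev (inv (t (σ′ x))) ≡ x
        invˡ {x} a with onCycle? x
        ... | yes c = begin
          prev (inv (t (σ′ x)))   ≡⟨ cong (prev ∘ inv ∘ t) (σ′-on c) ⟩
          prev (h x)              ≡⟨ prev-on (h-onCycle c) ⟩
          fold (h x) h p          ≡⟨ fold-comm h x p ⟩
          fold x h (suc p)        ≡⟨ proj₂ c ⟩
          x                       ∎
          where open ≡-Reasoning
        ... | no ¬c = begin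
          prev (inv (t (σ′ x)))   ≡⟨ cong (prev ∘ inv ∘ t) (σ′-off ¬c) ⟩
          prev (inv (t (σ x)))    ≡⟨ cong prev (inverseˡ a) ⟩
          prev x                  ≡⟨ prev-off ¬c ⟩
          x                       ∎
          where open ≡-Reasoning

        invʳ : ∀ {z} → A z → t (σ′ (prev (inv z))) ≡ z
        invʳ {z} a with onCycle? (inv z)
        ... | no ¬c = trans (cong (t ∘ σ′) (prev-off ¬c)) (trans (cong t (σ′-off ¬c)) (inverseʳ a))
        ... | yes c = begin
          t (σ′ (prev (inv z)))   ≡⟨ cong (t ∘ σ′) (prev-on c) ⟩
          t (σ′ y)                ≡⟨ cong t (σ′-on (fold-onCycle p c)) ⟩
          t (g y)                 ≡⟨ inverseʳ (A-t (g y)) ⟨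
          t (σ (h y))             ≡⟨ cong (t ∘ σ) (proj₂ c) ⟩
          t (σ (inv z))           ≡⟨ inverseʳ a ⟩
          z                       ∎
          where
          open ≡-Reasoning
          y = fold (inv z) h p

    -- Iterating h from any point of U reaches a cycle, so at least one vertex really receives its
    -- g-edge.
    switch : Nonempty U → ∃ λ σ′ → IsCover σ′ × LoopsOutside U σ′ ×
      (∀ x → σ′ x ≡ σ x ⊎ (x ∈ U × σ′ x ≡ g x)) × (∃ λ x → x ∈ U × σ′ x ≡ g x)
    switch (x₀ , x₀∈U) with periodic-point h x₀
    ... | i , p , eq = σ′ , σ′-isCover , σ′-loops , σ′-cases ,
        fold x₀ h i , fold-h∈U i x₀∈U , σ′-on (fold-h∈U i x₀∈U , eq)
      where open Periodic p

  -- Pivots, elimination of edges, and the count against S.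

  module Forcing (S : Subset m)
    (separates : ∀ {σ σ′} → IsCover σ → IsCover σ′ →
      selected σ ∩ S ≡ selected σ′ ∩ S → ∀ {x} → A x → σ x ≡ σ′ x) where

    -- The condition `t e ∈ U` places the B-end of e in X.
    Pivot : Subset n → Fin n → Set
    Pivot U x = ∀ {e f} → s e ≡ x → s f ≡ x → t e ∈ U → t f ∈ U → e ∉ S → f ∉ S → e ≡ f

    -- Minimising |N ∩ S| becomes a well-founded recursion that starts from N = M, the cover by
    -- loops.
    pivot : ∀ U → (∀ {x} → x ∈ U → A x) → Nonempty U → ∃ λ x → x ∈ U × Pivot U x
    pivot U U⊆A U≢∅ = go loop-isCover (λ _ _ → refl) (<-wellFounded _)
      where
      go : ∀ {σ} → IsCover σ → LoopsOutside U σ → Acc _<_ ∣ selected σ ∩ S ∣ →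
        ∃ λ x → x ∈ U × Pivot U x
      go {σ} cover loops (acc rec) = result
        where
        Free : Fin n → Fin m → Set
        Free x e = s e ≡ x × t e ∈ U × e ∉ S × e ≢ σ x

        free? : ∀ x → Decidable (Free x)
        free? x e = (s e ≟ x) ×-dec (t e ∈? U) ×-dec ¬? (e ∈? S) ×-dec ¬? (e ≟ σ x)

        HasFree : Fin n → Set
        HasFree x = x ∈ U → ∃ (Free x)

        hasFree? : Decidable HasFree
        hasFree? x = (x ∈? U) →-dec any? (free? x)

        decrease : (∀ x → HasFree x) → ∃ λ x → x ∈ U × Pivot U x
        decrease hasFree = finish
          (Switch.switch cover U U⊆A loops g (proj₁ ∘ free) (proj₁ ∘ proj₂ ∘ free) U≢∅)
          where
          g : Fin n → Fin m
          g x with x ∈? U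
          ... | yes x∈U = proj₁ (hasFree x x∈U)
          -- A default value: `Switch` constrains g only on U.
          ... | no _    = loop x

          free : ∀ {x} → x ∈ U → Free x (g x)
          free {x} x∈U with x ∈? U
          ... | yes x∈U′ = proj₂ (hasFree x x∈U′)
          ... | no x∉U   = contradiction x∈U x∉U

          finish : (∃ λ σ′ → IsCover σ′ × LoopsOutside U σ′ ×
            (∀ x → σ′ x ≡ σ x ⊎ (x ∈ U × σ′ x ≡ g x)) × (∃ λ x → x ∈ U × σ′ x ≡ g x)) →
            ∃ λ x → x ∈ U × Pivot U x
          finish (σ′ , cover′ , loops′ , cases , x , x∈U , σ′x≡gx) with ⊆⇒≡⊎⊂ shrinks
            where
            -- Edges gained by the switch are free, hence outside S.
            shrinks : selected σ′ ∩ S ⊆ selected σ ∩ S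
            shrinks {e} e∈ with x∈p∩q⁻ (selected σ′) S e∈
            ... | e∈σ′ , e∈S with ∈-selected⁻ σ′ e∈σ′ | cases (s e)
            ...   | σ′≡e | inj₁ σ′≡σ =
              x∈p∩q⁺ (∈-selected⁺ σ (trans (sym σ′≡σ) σ′≡e) , e∈S)
            ...   | σ′≡e | inj₂ (se∈U , σ′≡g) = contradiction
              (subst (_∈ S) (trans (sym σ′≡e) σ′≡g) e∈S) (proj₁ (proj₂ (proj₂ (free se∈U))))
          ... | inj₂ smaller = go cover′ loops′ (rec (p⊂q⇒∣p∣<∣q∣ smaller))
          -- Equal traces would force σ′ and σ to agree at x, but the free edge `g x` differs from
          -- `σ x`.
          ... | inj₁ same    = contradiction
            (trans (sym σ′x≡gx) (separates cover′ cover same (U⊆A x∈U)))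
            (proj₂ (proj₂ (proj₂ (free x∈U))))

        result : ∃ λ x → x ∈ U × Pivot U x
        result with all? hasFree?
        ... | yes hasFree = decrease hasFree
        ... | no ¬hasFree with ¬∀⟶∃¬ n HasFree hasFree? ¬hasFree
        -- Without a free edge at x, each edge of G[X] at x outside S is `σ x`.
        ...   | x , ¬free = x , x∈U , λ se sf te tf e∉S f∉S →
                trans (≡σx se te e∉S) (sym (≡σx sf tf f∉S))
          where
          x∈U : x ∈ U
          x∈U = decidable-stable (x ∈? U) λ x∉U → ¬free λ x∈U → contradiction x∈U x∉U

          ≡σx : ∀ {e} → s e ≡ x → t e ∈ U → e ∉ S → e ≡ σ x
          ≡σx {e} se te e∉S = decidable-stable (e ≟ σ x) λ e≢ → ¬free λ _ → e , se , te , e∉S , e≢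

    -- F holds the edges discarded while U is emptied. The fields `nonLoop`, `loop∈S` and `once`
    -- serve the count, `s∈U` separates successive rounds, and `forces` is anti-forcing among
    -- matchings that agree with M outside U.
    record Eliminates (U : Subset n) (F : Subset m) : Set where
      field
        s∈U      : ∀ {e} → e ∈ F → s e ∈ U
        nonLoop  : ∀ {e} → e ∈ F → e ≢ loop (s e)
        loop∈S   : ∀ {e} → e ∈ F → e ∉ S → loop (s e) ∈ S
        once     : ∀ {e f} → e ∈ F → f ∈ F → e ∉ S → f ∉ S → s e ≡ s f → e ≡ f
        forces   : ∀ {ρ} → (∀ {x} → A x → s (ρ x) ≡ x) →
          (∀ {x y} → A x → A y → t (ρ x) ≡ t (ρ y) → x ≡ y) →
          LoopsOutside U ρ → (∀ {x} → A x → ρ x ∉ F) → ∀ {x} → A x → ρ x ≡ loop x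

    eliminate : ∀ U → (∀ {x} → x ∈ U → A x) → ∃ (Eliminates U)
    eliminate U U⊆A = go U U⊆A (<-wellFounded _)
      where
      go : ∀ U → (∀ {x} → x ∈ U → A x) → Acc _<_ ∣ U ∣ → ∃ (Eliminates U)
      go U U⊆A (acc rec) with nonempty? U
      ... | no U≡∅ = ⊥ , record
        { s∈U = λ e∈ → contradiction e∈ ∉⊥ ; nonLoop = λ e∈ → contradiction e∈ ∉⊥
        ; loop∈S = λ e∈ → contradiction e∈ ∉⊥ ; once = λ e∈ → contradiction e∈ ∉⊥
        ; forces = λ _ _ loops _ a → loops a λ x∈U → U≡∅ (_ , x∈U) }
      ... | yes U≢∅ with pivot U U⊆A U≢∅
      ...   | x , x∈U , atMostOne with go (U - x) (U⊆A ∘ p─q⊆p U _) (rec (x∈p⇒∣p-x∣<∣p∣ x∈U))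
      ...     | F , elim = Fₓ ∪ F , record
        { s∈U = s∈U′ ; nonLoop = nonLoop′ ; loop∈S = loop∈S′ ; once = once′ ; forces = forces′ }
        where
        open Eliminates elim
        a = U⊆A x∈U

        Out : Fin m → Set
        Out e = s e ≡ x × t e ∈ U × e ≢ loop x

        out? : Decidable Out
        out? e = (s e ≟ x) ×-dec (t e ∈? U) ×-dec ¬? (e ≟ loop x)

        Fₓ : Subset m
        Fₓ = toSubset out?

        split : ∀ {e} → e ∈ Fₓ ∪ F → Out e ⊎ e ∈ F
        split e∈ with x∈p∪q⁻ Fₓ F e∈
        ... | inj₁ e∈Fₓ = inj₁ (∈-toSubset⁻ out? e∈Fₓ)
        ... | inj₂ e∈F  = inj₂ e∈F

        s≢x : ∀ {e} → e ∈ F → s e ≢ x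
        s≢x e∈F refl = x∉p-x U (s∈U e∈F)

        s∈U′ : ∀ {e} → e ∈ Fₓ ∪ F → s e ∈ U
        s∈U′ e∈ with split e∈
        ... | inj₁ (refl , _) = x∈U
        ... | inj₂ e∈F        = p─q⊆p U _ (s∈U e∈F)

        nonLoop′ : ∀ {e} → e ∈ Fₓ ∪ F → e ≢ loop (s e)
        nonLoop′ e∈ with split e∈
        ... | inj₁ (refl , _ , e≢) = e≢
        ... | inj₂ e∈F             = nonLoop e∈F

        loop∈S′ : ∀ {e} → e ∈ Fₓ ∪ F → e ∉ S → loop (s e) ∈ S
        loop∈S′ e∈ e∉S with split e∈
        ... | inj₂ e∈F               = loop∈S e∈F e∉S
        -- The loop at the pivot also has its target in U, so if it too avoided S it would coincide
        -- with e.
        ... | inj₁ (refl , te , e≢)  = decidable-stable (_ ∈? S) λ l∉S → e≢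
          (atMostOne refl (s-loop a) te (subst (_∈ U) (sym (t-loop a)) x∈U) e∉S l∉S)

        once′ : ∀ {e f} → e ∈ Fₓ ∪ F → f ∈ Fₓ ∪ F → e ∉ S → f ∉ S → s e ≡ s f → e ≡ f
        once′ e∈ f∈ e∉S f∉S eq with split e∈ | split f∈
        ... | inj₁ (se , te , _) | inj₁ (sf , tf , _) = atMostOne se sf te tf e∉S f∉S
        ... | inj₁ (se , _)      | inj₂ f∈F           = contradiction (trans (sym eq) se) (s≢x f∈F)
        ... | inj₂ e∈F           | inj₁ (sf , _)      = contradiction (trans eq sf) (s≢x e∈F)
        ... | inj₂ e∈F           | inj₂ f∈F           = once e∈F f∈F e∉S f∉S eq

        -- The edge of ρ at the pivot stays in G[X] and avoids `Fₓ`, so it is the loop; `forces` for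
        -- `U - x` settles the rest.
        forces′ : ∀ {ρ} → (∀ {x} → A x → s (ρ x) ≡ x) →
          (∀ {x y} → A x → A y → t (ρ x) ≡ t (ρ y) → x ≡ y) →
          LoopsOutside U ρ → (∀ {x} → A x → ρ x ∉ Fₓ ∪ F) → ∀ {x} → A x → ρ x ≡ loop x
        forces′ {ρ} s-ρ inj loops avoids = forces s-ρ inj loops-x λ b → avoids b ∘ x∈p∪q⁺ ∘ inj₂
          where
          -- The end of an edge leaving U is already taken by the loop there.
          t∈U : t (ρ x) ∈ U
          t∈U = decidable-stable (_ ∈? U) λ t∉U → t∉U (subst (_∈ U)
            (inj a (A-t _) (sym (trans (cong t (loops (A-t _) t∉U)) (t-loop (A-t _))))) x∈U)

          ρx≡loop : ρ x ≡ loop x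
          ρx≡loop = decidable-stable (_ ≟ _) λ ρx≢ →
            avoids a (x∈p∪q⁺ (inj₁ (∈-toSubset⁺ out? (s-ρ a , t∈U , ρx≢))))

          loops-x : LoopsOutside (U - x) ρ
          loops-x {y} b y∉ with y ≟ x
          ... | yes refl = ρx≡loop
          ... | no y≢x   = loops b λ y∈U → y∉ (x∈p∧x≢y⇒x∈p-y y∈U y≢x)

    -- Edges of F in S are kept, and the others go to the loop at their source. No loop lies in F
    -- and each source has at most one edge of F outside S, so this is injective.
    Eliminates⇒∣F∣≤∣S∣ : ∀ {U F} → Eliminates U F → ∣ F ∣ ≤ ∣ S ∣
    Eliminates⇒∣F∣≤∣S∣ {F = F} elim = injection⇒∣p∣≤∣q∣ F S φ φ∈S φ-injective
      where
      open Eliminates elim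
      φ : Fin m → Fin m
      φ e with e ∈? S
      ... | yes _ = e
      ... | no _  = loop (s e)

      φ∈S : ∀ {e} → e ∈ F → φ e ∈ S
      φ∈S {e} e∈F with e ∈? S
      ... | yes e∈S = e∈S
      ... | no e∉S  = loop∈S e∈F e∉S

      s-loop-s : ∀ e → s (loop (s e)) ≡ s e
      s-loop-s e = s-loop (A-s e)

      φ-injective : ∀ {e f} → e ∈ F → f ∈ F → φ e ≡ φ f → e ≡ f
      φ-injective {e} {f} e∈F f∈F eq with e ∈? S | f ∈? S
      ... | yes _  | yes _  = eq
      ... | yes _  | no _   = contradiction
        (trans eq (cong loop (trans (sym (s-loop-s f)) (cong s (sym eq))))) (nonLoop e∈F)
      ... | no _   | yes _  = contradiction
        (trans (sym eq) (cong loop (trans (sym (s-loop-s e)) (cong s eq)))) (nonLoop f∈F)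
      ... | no e∉S | no f∉S = once e∈F f∈F e∉S f∉S
        (trans (sym (s-loop-s e)) (trans (cong s eq) (s-loop-s f)))

-- Edge ends by colour, and perfect matchings of a bipartite graph.

module BipartiteGraph (G : Graph) (bipartite : Bipartite G) where

  color = proj₁ bipartite

  A B : Fin (n G) → Set
  A x = color x ≡ true
  B x = color x ≡ false

  A⊎B : ∀ x → A x ⊎ B x
  A⊎B x with color x
  ... | true  = inj₁ refl
  ... | false = inj₂ refl

  A∧B⇒ : ∀ {X : Set} {x} → A x → B x → X
  A∧B⇒ a b = contradiction (trans (sym a) b) λ ()

  oriented : ∀ e → ∃₂ λ x y → A x × B y × Incident G e x × Incident G e y ×
    (∀ {z} → Incident G e z → x ≡ z ⊎ y ≡ z)
  oriented e with A⊎B (end₁ G e) | A⊎B (end₂ G e)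
  ... | inj₁ a₁ | inj₁ a₂ = contradiction (trans a₁ (sym a₂)) (proj₂ bipartite e)
  ... | inj₂ b₁ | inj₂ b₂ = contradiction (trans b₁ (sym b₂)) (proj₂ bipartite e)
  ... | inj₁ a  | inj₂ b  = _ , _ , a , b , inj₁ refl , inj₂ refl , λ i → i
  ... | inj₂ b  | inj₁ a  = _ , _ , a , b , inj₂ refl , inj₁ refl , swap

  α β : Fin (m G) → Fin (n G)
  α e = proj₁ (oriented e)
  β e = proj₁ (proj₂ (oriented e))

  A-α : ∀ e → A (α e)
  A-α e = proj₁ (proj₂ (proj₂ (oriented e)))

  B-β : ∀ e → B (β e)
  B-β e = proj₁ (proj₂ (proj₂ (proj₂ (oriented e))))

  incident-α : ∀ e → Incident G e (α e)
  incident-α e = proj₁ (proj₂ (proj₂ (proj₂ (proj₂ (oriented e)))))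

  incident-β : ∀ e → Incident G e (β e)
  incident-β e = proj₁ (proj₂ (proj₂ (proj₂ (proj₂ (proj₂ (oriented e))))))

  incident⇒α : ∀ {e x} → A x → Incident G e x → α e ≡ x
  incident⇒α {e} a i with proj₂ (proj₂ (proj₂ (proj₂ (proj₂ (proj₂ (oriented e)))))) i
  ... | inj₁ eq   = eq
  ... | inj₂ refl = A∧B⇒ a (B-β e)

  incident⇒β : ∀ {e x} → B x → Incident G e x → β e ≡ x
  incident⇒β {e} b i with proj₂ (proj₂ (proj₂ (proj₂ (proj₂ (proj₂ (oriented e)))))) i
  ... | inj₁ refl = A∧B⇒ (A-α e) b
  ... | inj₂ eq   = eq

  module Matching {M} (pm : IsPerfectMatching G M) where

    at : Fin (n G) → Fin (m G)
    at x = proj₁ (proj₁ (pm x))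

    at∈M : ∀ x → at x ∈ M
    at∈M x = proj₁ (proj₂ (proj₁ (pm x)))

    incident-at : ∀ x → Incident G (at x) x
    incident-at x = proj₂ (proj₂ (proj₁ (pm x)))

    α-at : ∀ {x} → A x → α (at x) ≡ x
    α-at {x} a = incident⇒α a (incident-at x)

    β-at : ∀ {x} → B x → β (at x) ≡ x
    β-at {x} b = incident⇒β b (incident-at x)

    at-unique : ∀ {e x} → e ∈ M → Incident G e x → at x ≡ e
    at-unique {e} {x} e∈M i = proj₂ (pm x) _ _ (at∈M x) e∈M (incident-at x) i

    at-α : ∀ {e} → e ∈ M → at (α e) ≡ e
    at-α {e} e∈M = at-unique e∈M (incident-α e)

    at-β : ∀ {e} → e ∈ M → at (β e) ≡ e
    at-β {e} e∈M = at-unique e∈M (incident-β e)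

  -- Contraction of a perfect matching and the anti-forcing bound.

  module Contracted {M} (pm : IsPerfectMatching G M) where

    open Matching pm

    -- The M-partner of the B-end of e.
    target : Fin (m G) → Fin (n G)
    target e = α (at (β e))

    target-at : ∀ {x} → A x → target (at x) ≡ x
    target-at {x} a = trans (cong α (at-β (at∈M x))) (α-at a)

    α∘at-injective : ∀ {x y} → B x → B y → α (at x) ≡ α (at y) → x ≡ y
    α∘at-injective {x} {y} bx by eq = begin
      x                      ≡⟨ β-at bx ⟨
      β (at x)               ≡⟨ cong β (at-α (at∈M x)) ⟨
      β (at (α (at x)))      ≡⟨ cong (β ∘ at) eq ⟩
      β (at (α (at y)))      ≡⟨ cong β (at-α (at∈M y)) ⟩
      β (at y)               ≡⟨ β-at by ⟩
      y                      ∎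
      where open ≡-Reasoning

    open Digraph A α target at A-α (λ e → A-α (at (β e))) α-at target-at public

    -- All selected edges at a vertex share one source w: the vertex itself if it is in A, otherwise
    -- the `inv`-image of its M-partner.
    selected-isPerfectMatching : ∀ {σ} → IsCover σ → IsPerfectMatching G (selected σ)
    selected-isPerfectMatching {σ} cover = λ x → perfect (A⊎B x)
      where
      open IsCover cover

      perfectAt : ∀ {x} w → A w → Incident G (σ w) x →
        (∀ {e} → e ∈ selected σ → Incident G e x → α e ≡ w) →
        (∃ λ e → e ∈ selected σ × Incident G e x) ×
        (∀ e f → e ∈ selected σ → f ∈ selected σ → Incident G e x → Incident G f x → e ≡ f)
      perfectAt {x} w a incident α≡w =
        (σ w , ∈-selected⁺ σ (cong σ (s-σ a)) , incident) ,
        λ e f e∈ f∈ i j → trans (≡σw e∈ i) (sym (≡σw f∈ j))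
        where
        ≡σw : ∀ {e} → e ∈ selected σ → Incident G e x → e ≡ σ w
        ≡σw e∈ i = trans (sym (∈-selected⁻ σ e∈)) (cong σ (α≡w e∈ i))

      perfect : ∀ {x} → A x ⊎ B x →
        (∃ λ e → e ∈ selected σ × Incident G e x) ×
        (∀ e f → e ∈ selected σ → f ∈ selected σ → Incident G e x → Incident G f x → e ≡ f)
      perfect {x} (inj₁ a) = perfectAt x a
        (subst (Incident G (σ x)) (s-σ a) (incident-α (σ x))) (λ _ → incident⇒α a)
      perfect {x} (inj₂ b) = perfectAt w (A-inv (A-α (at x)))
        (subst (Incident G (σ w)) β-σw (incident-β (σ w))) α≡w
        where
        w : Fin (n G)
        w = inv (α (at x))

        β-σw : β (σ w) ≡ x
        β-σw = α∘at-injective (B-β (σ w)) b (inverseʳ (A-α (at x)))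

        α≡w : ∀ {e} → e ∈ selected σ → Incident G e x → α e ≡ w
        α≡w {e} e∈ i = begin
          α e                       ≡⟨ inverseˡ (A-α e) ⟨
          inv (target (σ (α e)))    ≡⟨ cong (inv ∘ target) (∈-selected⁻ σ e∈) ⟩
          inv (α (at (β e)))        ≡⟨ cong (inv ∘ α ∘ at) (incident⇒β b i) ⟩
          w                         ∎
          where open ≡-Reasoning

    -- A cover is recovered on A from its matching, since `σ x` is the selected edge with source x.
    globalForcing⇒separates : ∀ {S} → IsGlobalForcingSet G S → ∀ {σ σ′} →
      IsCover σ → IsCover σ′ → selected σ ∩ S ≡ selected σ′ ∩ S → ∀ {x} → A x → σ x ≡ σ′ x
    globalForcing⇒separates gfs {σ} {σ′} cover cover′ same {x} a = sym (begin
      σ′ x            ≡⟨ cong σ′ (s-σ a) ⟨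
      σ′ (α (σ x))    ≡⟨ ∈-selected⁻ σ′ (subst (σ x ∈_) equal σx∈) ⟩
      σ x             ∎)
      where
      open ≡-Reasoning
      open IsCover cover
      σx∈ : σ x ∈ selected σ
      σx∈ = ∈-selected⁺ σ (cong σ (s-σ a))

      equal : selected σ ≡ selected σ′
      equal = gfs _ _ (selected-isPerfectMatching cover) (selected-isPerfectMatching cover′) same

  globalForcing⇒antiForcing : ∀ {M S} → IsPerfectMatching G M → IsGlobalForcingSet G S →
    ∃ λ F → IsAntiForcingSet G M F × ∣ F ∣ ≤ ∣ S ∣
  globalForcing⇒antiForcing {M} {S} pm gfs = F , (F⊆∁M , unique) , Eliminates⇒∣F∣≤∣S∣ elim
    where
    open Matching pm
    open Contracted pm
    open Forcing S (globalForcing⇒separates gfs)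

    A? : Decidable A
    A? x = color x ≟ᵇ true

    -- Elimination starts from all of A, where `LoopsOutside` holds vacuously.
    F = proj₁ (eliminate (toSubset A?) (∈-toSubset⁻ A?))
    elim = proj₂ (eliminate (toSubset A?) (∈-toSubset⁻ A?))
    open Eliminates elim

    F⊆∁M : F ⊆ ∁ M
    F⊆∁M e∈F = x∉p⇒x∈∁p λ e∈M → nonLoop e∈F (sym (at-α e∈M))

    unique : ∀ M′ → IsPerfectMatching G M′ → M′ ∩ F ≡ ⊥ → M′ ≡ M
    unique M′ pm′ disjoint = ⊆-antisym
      (λ {e} e∈M′ → subst (_∈ M) (trans (sym (agree (A-α e))) (M′.at-α e∈M′)) (at∈M (α e)))
      (λ {e} e∈M → subst (_∈ M′) (trans (agree (A-α e)) (at-α e∈M)) (M′.at∈M (α e)))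
      where
      module M′ = Matching pm′
      -- Equal targets give equal B-ends, and M′ has a single edge there.
      injective : ∀ {x y} → A x → A y → target (M′.at x) ≡ target (M′.at y) → x ≡ y
      injective {x} {y} ax ay eq = begin
        x                       ≡⟨ M′.α-at ax ⟨
        α (M′.at x)              ≡⟨ cong α (M′.at-β (M′.at∈M x)) ⟨
        α (M′.at (β (M′.at x)))   ≡⟨ cong (α ∘ M′.at) (α∘at-injective (B-β _) (B-β _) eq) ⟩
        α (M′.at (β (M′.at y)))   ≡⟨ cong α (M′.at-β (M′.at∈M y)) ⟩
        α (M′.at y)              ≡⟨ M′.α-at ay ⟩
        y                       ∎
        where open ≡-Reasoning

      agree : ∀ {x} → A x → M′.at x ≡ at x
      agree = forces M′.α-at injective
        (λ a x∉A → contradiction (∈-toSubset⁺ A? a) x∉A)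
        (λ {x} _ at∈F → ∉⊥ (subst (M′.at x ∈_) disjoint (x∈p∩q⁺ (M′.at∈M x , at∈F))))

theorem3p3 : (G : Graph) → Bipartite G → (∃ λ M → IsPerfectMatching G M) →
    (g a : ℕ) → IsGf G g → IsAfMax G a → g ≥ a
theorem3p3 G bipartite _ g a ((S , gfs , refl) , _) ((M , pm , _ , least) , _)
  with BipartiteGraph.globalForcing⇒antiForcing G bipartite pm gfs
... | F , antiForcing , ∣F∣≤∣S∣ = ≤-trans (least F antiForcing) ∣F∣≤∣S∣
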